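{- Let $r \geq 5$ be an odd integer and let $k$ be an integer with $2k \geq r+5$. For every integer $n \geq 2kr$, \[ \textup{sat}(n, C_r, C_{2k}) = 0, \] i.e., there exists an $n$-vertex $C_{2k}$-saturated graph containing no cycle of length $r$ as a subgraph.
   Context: All graphs are finite and simple; $C_m$ denotes the cycle of length $m$. For a graph $F$, a graph $G$ is $F$-saturated if $G$ does not contain $F$ as a subgraph, but adding any edge between two nonadjacent vertices of $G$ creates a copy of $F$. For graphs $H$ and $F$, $\textup{sat}(n,H,F)$ denotes the minimum number of copies of $H$ (as subgraphs) in an $n$-vertex $F$-saturated graph. -}

module Defs where

open import Data.Nat using (ℕ; zero; suc; _≤_)
open import Data.Fin using (Fin; zero; suc; inject₁; fromℕ)
open import Data.Product using (Σ; _×_)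
open import Data.Sum using (_⊎_)
open import Data.Empty using (⊥)
open import Relation.Nullary using (¬_)
open import Relation.Binary.PropositionalEquality using (_≡_; _≢_)
open import Function.Definitions using (Injective)

record SimpleGraph (n : ℕ) : Set₁ where
  field
    Adj   : Fin n → Fin n → Set
    sym   : ∀ {x y} → Adj x y → Adj y x
    irrefl : ∀ {x} → ¬ Adj x x
open SimpleGraph public

AddEdge : ∀ {n} → (Fin n → Fin n → Set) → Fin n → Fin n → (Fin n → Fin n → Set)
AddEdge E u v x y = E x y ⊎ ((x ≡ u × y ≡ v) ⊎ (x ≡ v × y ≡ u))

ContainsCycle : ∀ {n} → (Fin n → Fin n → Set) → ℕ → Set
ContainsCycle {n} E zero = ⊥
ContainsCycle {n} E (suc m) =
  3 ≤ suc m ×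
  Σ (Fin (suc m) → Fin n) λ f →
    Injective _≡_ _≡_ f ×
    ((∀ (i : Fin m) → E (f (inject₁ i)) (f (suc i))) ×
     E (f (fromℕ m)) (f zero))

CycleSaturated : ∀ {n} → SimpleGraph n → ℕ → Set
CycleSaturated {n} G m =
  ¬ ContainsCycle (Adj G) m ×
  (∀ (u v : Fin n) → u ≢ v → ¬ Adj G u v → ContainsCycle (AddEdge (Adj G) u v) m)

{-# OPTIONS --safe #-}
module Submission where

-- Arrange r + 2 complete bipartite graphs in a ring, consecutive ones sharing a cut vertex, such that
-- the two cut vertices of each block lie on opposite sides. Opening the ring at a cut vertex leaves a
-- bipartite graph. Hence a cycle of odd length meets all r + 2 cut vertices and is not a C_r, and a
-- cycle of even length stays in one block, whose smaller side has fewer than k vertices.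
-- Conversely, of the two directions around the ring in which nonadjacent vertices can be joined,
-- one gives paths of odd length (for vertices of the same block, any way around does). The shortest
-- of them has length at most r + 4 ≤ 2k - 1, detours inside two blocks lengthen it in steps of 2 up
-- to 2k - 1, and adding the missing edge closes a C_2k.

open import Defs
open import Data.Bool using (Bool; true; false; not; _xor_)
open import Data.Bool.Properties using (not-distribˡ-xor; not-involutive; xor-identityʳ; not-¬)
open import Data.Empty using (⊥)
open import Data.Fin using (Fin; zero; suc; toℕ; fromℕ; fromℕ<; inject₁; inject≤; punchIn)
import Data.Fin as F
open import Data.Fin.Properties using (_≟_; toℕ-injective; toℕ<n; toℕ-fromℕ<; toℕ-fromℕ; toℕ-inject₁; pigeonhole; any?; suc-injective; inject≤-injective; punchIn-injective; punchInᵢ≢i; +↔⊎; *↔×)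
open import Data.Fin.Relation.Unary.Top using (view; ‵fromℕ; ‵inject₁)
open import Data.List using (List; []; _∷_; _++_; length)
open import Data.List.Properties using (length-++)
open import Data.List.Relation.Unary.All as All using (All; []; _∷_)
import Data.List.Relation.Unary.All.Properties as All
open import Data.List.Relation.Unary.AllPairs using ([]; _∷_)
open import Data.List.Relation.Unary.Unique.Propositional using (Unique)
import Data.List.Relation.Unary.Unique.Propositional.Properties as Unique
open import Data.Nat using (ℕ; zero; suc; pred; _+_; _*_; _∸_; _⊓_; _≤_; _<_; z≤n; s≤s)
open import Data.Nat.Divisibility using (_∣_; divides)
open import Data.Nat.DivMod using (_%_; _mod_; m%n<n; [m+n]%n≡m%n; %-distribˡ-+; m%n%n≡m%n; m<n⇒m%n≡m; n%n≡0)
open import Data.Nat.Properties hiding (_≟_; suc-injective)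
open import Data.Nat.Solver using (module +-*-Solver)
open import Data.Product using (Σ; ∃; _×_; _,_; proj₁; proj₂)
open import Data.Sum using (_⊎_; inj₁; inj₂; swap; [_,_]′)
open import Data.Sum.Function.Propositional using (_⊎-↔_)
open import Function using (_∘_; case_of_; _↔_; Inverse; mk↔ₛ′)
open import Function.Definitions using (Injective)
open import Function.Properties.Inverse using (↔-refl; ↔-trans)
open import Relation.Binary.Definitions using (tri<; tri≈; tri>)
open import Relation.Binary.PropositionalEquality using (_≡_; _≢_; refl; trans; cong; cong₂; subst; subst₂; module ≡-Reasoning) renaming (sym to ≡-sym)
open import Relation.Nullary using (¬_; Dec; yes; no; contradiction)
open import Relation.Nullary.Decidable using (map′)
open +-*-Solver using (solve; _:+_; _:*_; _:=_; con)

-- Parity and residues.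

parity : ℕ → Bool
parity zero    = false
parity (suc n) = not (parity n)

parity-double : ∀ n → parity (n + n) ≡ false
parity-double zero = refl
parity-double (suc n) rewrite +-suc n n | parity-double n = refl

parity-+ : ∀ m n → parity (m + n) ≡ parity m xor parity n
parity-+ zero    n = refl
parity-+ (suc m) n = trans (cong not (parity-+ m n)) (not-distribˡ-xor (parity m) (parity n))

double-cancel-≤ : ∀ {x y} → x + x ≤ y + y → x ≤ y
double-cancel-≤ le = ≮⇒≥ λ y<x → <⇒≱ (+-mono-< y<x y<x) le

halve : ∀ n → ∃ λ q → n ≡ q + q ⊎ n ≡ suc (q + q)
halve zero = 0 , inj₁ refl
halve (suc n) with halve n
... | q , inj₁ refl = q , inj₂ refl
... | q , inj₂ refl = suc q , inj₁ (cong suc (≡-sym (+-suc q q)))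

alternating : (b : ℕ → Bool) (n : ℕ) → (∀ t → t < n → b (suc t) ≡ not (b t)) →
              b n ≡ parity n xor b 0
alternating b zero    flips = refl
alternating b (suc n) flips = begin
  b (suc n)               ≡⟨ flips n ≤-refl ⟩
  not (b n)               ≡⟨ cong not (alternating b n (λ t t<n → flips t (m≤n⇒m≤1+n t<n))) ⟩
  not (parity n xor b 0)  ≡⟨ not-distribˡ-xor (parity n) (b 0) ⟩
  parity (suc n) xor b 0  ∎
  where open ≡-Reasoning

%-cong-+ : ∀ {x y} z m → x % suc m ≡ y % suc m → (x + z) % suc m ≡ (y + z) % suc m
%-cong-+ {x} {y} z m eq = begin
  (x + z) % suc m                  ≡⟨ %-distribˡ-+ x z (suc m) ⟩
  (x % suc m + z % suc m) % suc m  ≡⟨ cong (λ w → (w + z % suc m) % suc m) eq ⟩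
  (y % suc m + z % suc m) % suc m  ≡⟨ %-distribˡ-+ y z (suc m) ⟨
  (y + z) % suc m                  ∎
  where open ≡-Reasoning

suc-% : ∀ s m → suc s % suc m ≡ suc (s % suc m) % suc m
suc-% s m = subst₂ (λ x y → x % suc m ≡ y % suc m) (+-comm s 1) (+-comm (s % suc m) 1)
  (%-cong-+ {s} {s % suc m} 1 m (≡-sym (m%n%n≡m%n s (suc m))))

-- Induction on `s`: adding `m` to both sides of a congruence lowers `suc s` to `s` modulo `suc m`,
-- down to `s = 0`, where `t` is its own residue.
%-shift-≢ : ∀ m s t → 0 < t → t < suc m → s % suc m ≢ (s + t) % suc m
%-shift-≢ m zero    t 0<t t<n eq = <⇒≢ 0<t (trans eq (m<n⇒m%n≡m t<n))
%-shift-≢ m (suc s) t 0<t t<n eq = %-shift-≢ m s t 0<t t<n (begin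
  s % suc m                ≡⟨ [m+n]%n≡m%n s (suc m) ⟨
  (s + suc m) % suc m      ≡⟨ cong (_% suc m) (+-suc s m) ⟩
  (suc s + m) % suc m      ≡⟨ %-cong-+ {suc s} {suc s + t} m m eq ⟩
  (suc s + t + m) % suc m  ≡⟨ cong (_% suc m) (+-suc (s + t) m) ⟨
  (s + t + suc m) % suc m  ≡⟨ [m+n]%n≡m%n (s + t) (suc m) ⟩
  (s + t) % suc m          ∎)
  where open ≡-Reasoning

-- Cycles as periodic sequences.

record CyclicSeq {A : Set} (E : A → A → Set) (n : ℕ) : Set where
  field
    at       : ℕ → A
    edge     : ∀ s → E (at s) (at (suc s))
    period   : ∀ s → at (s + n) ≡ at s
    distinct : ∀ s t → 0 < t → t < n → at s ≢ at (s + t)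

-- Indices in ℕ, reduced modulo the length, let a cycle be read from any of its vertices and treat
-- the closing edge like all others.
unroll : ∀ {A : Set} {E : A → A → Set} {m} (f : Fin (suc m) → A) → Injective _≡_ _≡_ f →
         (∀ i → E (f (inject₁ i)) (f (suc i))) → E (f (fromℕ m)) (f zero) → CyclicSeq E (suc m)
unroll {E = E} {m} f f-inj steps close = record
  { at       = λ s → f (s mod suc m)
  ; edge     = λ s → step (s mod suc m) (suc s mod suc m) (next s)
  ; period   = λ s → cong f (toℕ-injective (trans (toℕ-mod (s + suc m))
                 (trans ([m+n]%n≡m%n s (suc m)) (≡-sym (toℕ-mod s)))))
  ; distinct = λ s t 0<t t<n eq → %-shift-≢ m s t 0<t t<n
                 (trans (≡-sym (toℕ-mod s)) (trans (cong toℕ (f-inj eq)) (toℕ-mod (s + t))))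
  }
  where
  toℕ-mod : ∀ s → toℕ (s mod suc m) ≡ s % suc m
  toℕ-mod s = toℕ-fromℕ< (m%n<n s (suc m))
  next : ∀ s → toℕ (suc s mod suc m) ≡ suc (toℕ (s mod suc m)) % suc m
  next s = trans (toℕ-mod (suc s)) (trans (suc-% s m) (cong (λ x → suc x % suc m) (≡-sym (toℕ-mod s))))
  step : ∀ i j → toℕ j ≡ suc (toℕ i) % suc m → E (f i) (f j)
  step i j eq with view i
  ... | ‵fromℕ = subst (E _ ∘ f) (toℕ-injective (≡-sym (trans eq
    (trans (cong (λ x → suc x % suc m) (toℕ-fromℕ m)) (n%n≡0 (suc m)))))) close
  ... | ‵inject₁ i = subst (E _ ∘ f) (toℕ-injective (≡-sym (trans eq
    (trans (cong (λ x → suc x % suc m) (toℕ-inject₁ i)) (m<n⇒m%n≡m (s≤s (toℕ<n i))))))) (steps i)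

-- The ring of complete bipartite blocks.

module Ring (d c e : ℕ) where

  data V : Set where
    cut   : Fin (suc d) → V
    left  : Fin (suc d) → Fin (suc c) → V
    right : Fin (suc d) → Fin (suc c) → V
    extra : Fin e → V

  -- A cut vertex lies in two blocks; it gets the index of the block that has it on the left side.
  idx : V → Fin (suc d)
  idx (cut i)     = i
  idx (left i _)  = i
  idx (right i _) = i
  idx (extra _)   = zero

  data Tail : V → Set where
    cut  : ∀ {i} → Tail (cut i)
    left : ∀ {i a} → Tail (left i a)

  data Right : V → Set where
    right : ∀ {i a} → Right (right i a)
    extra : ∀ {a} → Right (extra a)

  data Next : Fin (suc d) → Fin (suc d) → Set where
    step : ∀ {i j} → toℕ j ≡ suc (toℕ i) → Next i j
    wrap : ∀ {i j} → toℕ i ≡ d → toℕ j ≡ 0 → Next i j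

  -- Block i is complete bipartite, with all edges directed from its left side {cut i, left i _}
  -- to its right side {right i _, cut (i + 1)}. The vertices extra _ belong to the right side of
  -- block 0, so that any large number of vertices can be attained.
  data Dir : V → V → Set where
    inner : ∀ {x y} → Tail x → Right y → idx x ≡ idx y → Dir x y
    outer : ∀ {x j} → Tail x → Next (idx x) j → Dir x (cut j)

  Adjacent : V → V → Set
  Adjacent x y = Dir x y ⊎ Dir y x

  Next-injective : ∀ {i i′ j} → Next i j → Next i′ j → i ≡ i′
  Next-injective (step p)   (step q)   = toℕ-injective (cong pred (trans (≡-sym p) q))
  Next-injective (step p)   (wrap _ q) = contradiction (trans (≡-sym p) q) λ ()
  Next-injective (wrap _ q) (step p)   = contradiction (trans (≡-sym p) q) λ ()
  Next-injective (wrap p _) (wrap q _) = toℕ-injective (trans p (≡-sym q))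

  Next-irreflexive : 0 < d → ∀ {i} → ¬ Next i i
  Next-irreflexive 0<d (step p)   = 1+n≢n (≡-sym p)
  Next-irreflexive 0<d (wrap p q) = <⇒≢ 0<d (trans (≡-sym q) p)

  Adjacent-irreflexive : 0 < d → ∀ {x} → ¬ Adjacent x x
  Adjacent-irreflexive 0<d = λ { (inj₁ p) → irr p ; (inj₂ p) → irr p }
    where
    irr : ∀ {x} → ¬ Dir x x
    irr (inner cut () _)
    irr (inner left () _)
    irr (outer cut p) = Next-irreflexive 0<d p

  -- Every vertex, even a cut vertex, is on the right side of at most one block.
  Dir-block : ∀ {x x′ y} → Dir x y → Dir x′ y → idx x ≡ idx x′
  Dir-block (inner _ _ p) (inner _ _ q) = trans p (≡-sym q)
  Dir-block (outer _ p)   (outer _ q)   = Next-injective p q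
  Dir-block (outer _ p)   (inner _ () _)
  Dir-block (inner _ () _) (outer _ p)

  Dir-tail : ∀ {x y} → Dir x y → Tail x
  Dir-tail (inner p _ _) = p
  Dir-tail (outer p _)   = p

  passing-cut : ∀ {x y z} → Dir x y → Dir y z → ∃ λ j → y ≡ cut j
  passing-cut (outer _ _) _ = _ , refl
  passing-cut (inner _ right _) (inner () _ _)
  passing-cut (inner _ right _) (outer () _)
  passing-cut (inner _ extra _) (inner () _ _)
  passing-cut (inner _ extra _) (outer () _)

  -- Heights in the ring opened at a cut vertex.

  linearHeight : V → ℕ
  linearHeight (right i _) = suc (toℕ i)
  linearHeight (extra _)   = 1
  linearHeight x           = toℕ (idx x)

  -- The position of a vertex once the ring is cut open at cut j, so that heights run from j to j + suc d.
  height : Fin (suc d) → V → ℕ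
  height j x with toℕ (idx x) <? toℕ j
  ... | yes _ = linearHeight x + suc d
  ... | no  _ = linearHeight x

  height-before : ∀ {j x} → toℕ (idx x) < toℕ j → height j x ≡ linearHeight x + suc d
  height-before {j} {x} lt with toℕ (idx x) <? toℕ j
  ... | yes _ = refl
  ... | no ≮  = contradiction lt ≮

  height-after : ∀ {j x} → toℕ j ≤ toℕ (idx x) → height j x ≡ linearHeight x
  height-after {j} {x} j≤ with toℕ (idx x) <? toℕ j
  ... | yes lt = contradiction j≤ (<⇒≱ lt)
  ... | no _   = refl

  height-cut : ∀ j → height j (cut j) ≡ toℕ j
  height-cut j = height-after {j} {cut j} ≤-refl

  Tail-linearHeight : ∀ {x} → Tail x → linearHeight x ≡ toℕ (idx x)
  Tail-linearHeight cut  = refl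
  Tail-linearHeight left = refl

  Right-linearHeight : ∀ {x} → Right x → linearHeight x ≡ suc (toℕ (idx x))
  Right-linearHeight right = refl
  Right-linearHeight extra = refl

  -- Within a block, linear height rises by one from left to right. Lifting all indices before `j`
  -- by `suc d` makes the passage from block `d` to block 0 rise by one as well, so the only break
  -- is at `cut j`.
  height-step : ∀ j {x y} → Dir x y → y ≢ cut j → height j y ≡ suc (height j x)
  height-step j {x} {y} (inner p q i≡) _ with <-≤-connex (toℕ (idx x)) (toℕ j)
  ... | inj₁ lt = trans (height-before {j} {y} (subst (λ i → toℕ i < toℕ j) i≡ lt))
                    (trans (cong (_+ suc d) (trans (Right-linearHeight q) (cong suc (trans (cong toℕ (≡-sym i≡)) (≡-sym (Tail-linearHeight p))))))
                      (cong suc (≡-sym (height-before {j} {x} lt))))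
  ... | inj₂ ge = trans (height-after {j} {y} (subst (λ i → toℕ j ≤ toℕ i) i≡ ge))
                    (trans (Right-linearHeight q) (cong suc (trans (trans (cong toℕ (≡-sym i≡)) (≡-sym (Tail-linearHeight p)))
                      (≡-sym (height-after {j} {x} ge)))))
  height-step j {x} {cut l} (outer p (step l≡)) l≢j with <-≤-connex (toℕ (idx x)) (toℕ j)
  ... | inj₁ lt = trans (height-before {j} {cut l} (≤∧≢⇒< (subst (_≤ toℕ j) (≡-sym l≡) lt) (l≢j ∘ cong cut ∘ toℕ-injective)))
                    (trans (cong (_+ suc d) (trans l≡ (cong suc (≡-sym (Tail-linearHeight p)))))
                      (cong suc (≡-sym (height-before {j} {x} lt))))
  ... | inj₂ ge = trans (height-after {j} {cut l} (subst (toℕ j ≤_) (≡-sym l≡) (m≤n⇒m≤1+n ge)))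
                    (trans l≡ (cong suc (trans (≡-sym (Tail-linearHeight p)) (≡-sym (height-after {j} {x} ge)))))
  -- Here `l` is 0 and `j` is positive, so `cut l` is lifted to height `suc d`, while `x` stays at
  -- height `d`.
  height-step j {x} {cut l} (outer p (wrap i≡ l≡)) l≢j =
    trans (height-before {j} {cut l} (≤∧≢⇒< (subst (_≤ toℕ j) (≡-sym l≡) z≤n) (l≢j ∘ cong cut ∘ toℕ-injective)))
      (trans (cong (_+ suc d) l≡) (cong suc (≡-sym (trans (height-after {j} {x} (subst (toℕ j ≤_) (≡-sym i≡) (≤-pred (toℕ<n j))))
        (trans (Tail-linearHeight p) i≡)))))

  -- Such an edge starts in the last block of the opened ring. The vertex `cut j` itself counts as
  -- the bottom of the opened ring, not as its top.
  height-close : ∀ j {x} → Dir x (cut j) → height j x ≡ toℕ j + d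
  height-close j {x} (outer p (step j≡)) =
    trans (height-before {j} {x} (subst (_ <_) (≡-sym j≡) ≤-refl))
      (trans (cong (_+ suc d) (Tail-linearHeight p)) (trans (+-suc _ d) (cong (_+ d) (≡-sym j≡))))
  height-close j {x} (outer p (wrap i≡ j≡)) =
    trans (height-after {j} {x} (subst (_≤ toℕ (idx x)) (≡-sym j≡) z≤n))
      (trans (Tail-linearHeight p) (trans i≡ (cong (_+ d) (≡-sym j≡))))
  height-close j (inner _ () _)

  -- Colourings of the opened ring, and odd cycles.

  colour : Fin (suc d) → V → Bool
  colour j x = parity (height j x)

  colour-flip : ∀ j {x y} → Adjacent x y → x ≢ cut j → y ≢ cut j → colour j y ≡ not (colour j x)
  colour-flip j (inj₁ p) _ y≢ = cong parity (height-step j p y≢)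
  colour-flip j (inj₂ p) x≢ _ = trans (≡-sym (not-involutive _)) (cong not (≡-sym (cong parity (height-step j p x≢))))

  -- Away from `cut j` the colouring is proper, and an odd number of flips cannot lead back to the
  -- initial colour.
  cut-visited : ∀ {n} (S : CyclicSeq Adjacent n) → parity n ≡ true → ∀ j → ¬ (∀ s → CyclicSeq.at S s ≢ cut j)
  cut-visited {n} S odd j missed = not-¬ refl (trans (cong (colour j) (≡-sym (period 0)))
    (trans (alternating (colour j ∘ at) n λ t _ → colour-flip j (edge t) (missed t) (missed (suc t)))
      (cong (_xor colour j (at 0)) odd)))
    where open CyclicSeq S

  cut? : ∀ j x → Dec (x ≡ cut j)
  cut? j (cut i) = map′ (cong cut) (λ { refl → refl }) (i ≟ j)
  cut? j (left _ _)  = no λ ()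
  cut? j (right _ _) = no λ ()
  cut? j (extra _)   = no λ ()

  -- The `n` values of `f` include all `suc d` cut vertices, so the pigeonhole principle applies.
  odd-cycle-long : ∀ {n} (S : CyclicSeq Adjacent n) → parity n ≡ true →
                   (f : Fin n → V) → (∀ s → ∃ λ i → CyclicSeq.at S s ≡ f i) → suc d ≤ n
  odd-cycle-long {n} S odd f onto = ≮⇒≥ λ n<D → absurd (pigeonhole n<D (proj₁ ∘ visit))
    where
    visit : ∀ j → ∃ λ i → f i ≡ cut j
    visit j with any? (λ i → cut? j (f i))
    ... | yes v = v
    ... | no ¬v = contradiction (λ s eq → ¬v (proj₁ (onto s) , trans (≡-sym (proj₂ (onto s))) eq)) (cut-visited S odd j)
    absurd : ¬ (∃ λ i → ∃ λ j → i F.< j × proj₁ (visit i) ≡ proj₁ (visit j))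
    absurd (i , j , i<j , eq) with trans (≡-sym (proj₂ (visit i))) (trans (cong f eq) (proj₂ (visit j)))
    ... | refl = <-irrefl refl i<j

  -- The two neighbours have heights `toℕ j + d` and `toℕ j + 1`, which differ in parity because `d`
  -- is even.
  passing-colours : parity d ≡ false → ∀ {j x y} → Dir x (cut j) → Dir (cut j) y → y ≢ cut j → colour j x ≢ colour j y
  passing-colours even-d {j} {x} {y} p q y≢ eq = not-¬ {parity (toℕ j)} refl (begin
    parity (toℕ j)                  ≡⟨ xor-identityʳ _ ⟨
    parity (toℕ j) xor false        ≡⟨ cong (parity (toℕ j) xor_) even-d ⟨
    parity (toℕ j) xor parity d     ≡⟨ parity-+ (toℕ j) d ⟨
    parity (toℕ j + d)              ≡⟨ cong parity (height-close j p) ⟨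
    colour j x                      ≡⟨ eq ⟩
    colour j y                      ≡⟨ cong parity (height-step j q y≢) ⟩
    not (parity (height j (cut j))) ≡⟨ cong (not ∘ parity) (height-cut j) ⟩
    not (parity (toℕ j))            ∎)
    where open ≡-Reasoning

  -- Even cycles stay in one block.

  tailCode : V → Fin (2 + c)
  tailCode (left _ a) = suc a
  tailCode _          = zero

  tailCode-injective : ∀ {x y} → Tail x → Tail y → idx x ≡ idx y → tailCode x ≡ tailCode y → x ≡ y
  tailCode-injective cut  cut  refl _    = refl
  tailCode-injective left left refl refl = refl

  module EvenCycle {q} (even-q : parity q ≡ false) (even-d : parity d ≡ false) (S : CyclicSeq Adjacent (2 + q)) where
    open CyclicSeq S

    -- Opening the ring at a cut vertex which the cycle visits, the neighbours of that vertex on the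
    -- cycle are joined by a path of even length avoiding it.
    neighbour-colours : ∀ s j → at (suc s) ≡ cut j → colour j (at s) ≡ colour j (at (2 + s))
    neighbour-colours s j hit = begin
      colour j (at s)                           ≡⟨ cong (colour j) (period s) ⟨
      colour j (at (s + (2 + q)))               ≡⟨ cong (colour j ∘ at) (trans (+-suc s (suc q)) (cong suc (+-suc s q))) ⟩
      colour j (at (2 + s + q))                 ≡⟨ alternating (λ t → colour j (at (2 + s + t))) q flips ⟩
      parity q xor colour j (at (2 + s + 0))    ≡⟨ cong (_xor colour j (at (2 + s + 0))) even-q ⟩
      colour j (at (2 + s + 0))                 ≡⟨ cong (colour j ∘ at) (+-identityʳ (2 + s)) ⟩
      colour j (at (2 + s))                     ∎
      where
      open ≡-Reasoning
      avoids : ∀ t → t ≤ q → at (2 + s + t) ≢ cut j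
      avoids t t≤q eq = distinct (suc s) (suc t) (s≤s z≤n) (s≤s (s≤s t≤q))
        (trans hit (trans (≡-sym eq) (cong (at ∘ suc) (≡-sym (+-suc s t)))))
      flips : ∀ t → t < q → colour j (at (2 + s + suc t)) ≡ not (colour j (at (2 + s + t)))
      flips t t<q = trans (cong (colour j ∘ at) (+-suc (2 + s) t))
        (colour-flip j (edge (2 + s + t)) (avoids t (<⇒≤ t<q))
          (subst (λ z → at z ≢ cut j) (+-suc (2 + s) t) (avoids (suc t) t<q)))

    distinct₁ : ∀ s → at s ≢ at (suc s)
    distinct₁ s eq = distinct s 1 (s≤s z≤n) (s≤s (s≤s z≤n)) (trans eq (cong at (≡-sym (+-comm s 1))))

    -- The middle vertex would be a cut vertex, whose neighbours have different colours by
    -- `passing-colours` but equal ones by `neighbour-colours`.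
    no-passing : ∀ s → ¬ (Dir (at s) (at (suc s)) × Dir (at (suc s)) (at (2 + s)))
    no-passing s (p , r) with passing-cut p r
    ... | j , hit = passing-colours even-d (subst (Dir (at s)) hit p) (subst (λ v → Dir v (at (2 + s))) hit r)
      (λ eq → distinct₁ (suc s) (trans hit (≡-sym eq))) (neighbour-colours s j hit)

    no-passing-back : ∀ s → ¬ (Dir (at (suc s)) (at s) × Dir (at (2 + s)) (at (suc s)))
    no-passing-back s (p , r) with passing-cut r p
    ... | j , hit = passing-colours even-d (subst (Dir (at (2 + s))) hit r) (subst (λ v → Dir v (at s)) hit p)
      (λ eq → distinct₁ s (trans eq (≡-sym hit))) (≡-sym (neighbour-colours s j hit))

    forward : ∀ s → Dir (at s) (at (suc s)) → Dir (at (2 + s)) (at (suc s))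
    forward s p with edge (suc s)
    ... | inj₁ r = contradiction (p , r) (no-passing s)
    ... | inj₂ r = r

    backward : ∀ s → Dir (at (suc s)) (at s) → Dir (at (suc s)) (at (2 + s))
    backward s p with edge (suc s)
    ... | inj₁ r = r
    ... | inj₂ r = contradiction (p , r) (no-passing-back s)

    -- Edge directions alternate along the cycle, so every second vertex is a tail. Successive tails
    -- point to a common vertex, hence share their block.
    tails : ∀ s → Dir (at s) (at (suc s)) → ∀ a → Dir (at (a + a + s)) (at (suc (a + a + s))) × idx (at (a + a + s)) ≡ idx (at s)
    tails s p zero = p , refl
    tails s p (suc a) with tails s p a
    ... | r , i≡ rewrite +-suc a a = backward (suc (a + a + s)) (forward (a + a + s) r) ,
      trans (≡-sym (Dir-block r (forward (a + a + s) r))) i≡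

    start : ∃ λ s → Dir (at s) (at (suc s))
    start with edge 0
    ... | inj₁ p = 0 , p
    ... | inj₂ p = 1 , backward 0 p

    -- Half of the vertices of the cycle are distinct tails of one block, and `tailCode` leaves room
    -- for only `2 + c` of them.
    few-tails : ∀ k → k + k ≡ 2 + q → k ≤ 2 + c
    few-tails k k+k≡ = ≮⇒≥ λ 2+c<k → absurd (pigeonhole 2+c<k code)
      where
      s = proj₁ start
      vertex : Fin k → V
      vertex a = at (toℕ a + toℕ a + s)
      code : Fin k → Fin (2 + c)
      code a = tailCode (vertex a)
      tail : ∀ a → Dir (vertex a) _ × idx (vertex a) ≡ idx (at s)
      tail a = tails s (proj₂ start) (toℕ a)
      absurd : ¬ (∃ λ a → ∃ λ b → a F.< b × code a ≡ code b)
      absurd (a , b , a<b , eq) with m≤n⇒∃[o]m+o≡n a<b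
      -- As `b` exceeds `a` by `suc o`, the two positions differ by twice that, which is less than
      -- the length of the cycle.
      ... | o , o≡ = distinct (toℕ a + toℕ a + s) (suc o + suc o) (s≤s z≤n)
          (≤-<-trans (+-mono-≤ o< o<) (subst (toℕ b + toℕ b <_) k+k≡ (+-mono-< (toℕ<n b) (toℕ<n b))))
          (trans (tailCode-injective (Dir-tail (proj₁ (tail a))) (Dir-tail (proj₁ (tail b)))
            (trans (proj₂ (tail a)) (≡-sym (proj₂ (tail b)))) eq) (cong at shift))
        where
        b≡ : toℕ a + suc o ≡ toℕ b
        b≡ = trans (+-suc (toℕ a) o) o≡
        o< : suc o ≤ toℕ b
        o< = subst (suc o ≤_) b≡ (m≤n+m (suc o) (toℕ a))
        shift : toℕ b + toℕ b + s ≡ toℕ a + toℕ a + s + (suc o + suc o)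
        shift rewrite ≡-sym b≡ = solve 3 (λ x y z → (x :+ y) :+ (x :+ y) :+ z := x :+ x :+ z :+ (y :+ y)) refl (toℕ a) (suc o) s

  -- Paths of prescribed length

  data Walk : V → List V → V → Set where
    []  : ∀ {x} → Walk x [] x
    _∷_ : ∀ {x y z vs} → Adjacent x y → Walk y vs z → Walk x (x ∷ vs) z

  _++ʷ_ : ∀ {x y z us vs} → Walk x us y → Walk y vs z → Walk x (us ++ vs) z
  []      ++ʷ q = q
  (e ∷ p) ++ʷ q = e ∷ (p ++ʷ q)

  -- Paths from x to y of all lengths b, b + 2, …, b + 2w. Their vertices except y satisfy P, so that
  -- segments are concatenated by appending vertex lists.
  record Segment (x y : V) (P : V → Set) (b w : ℕ) : Set where
    constructor mkSegment
    field
      route : ∀ t → t ≤ w → ∃ λ vs → Walk x vs y × length vs ≡ b + (t + t) × Unique vs × All P vs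
  open Segment

  segment-mono : ∀ {x y b w w′} {P Q : V → Set} → (∀ {v} → P v → Q v) → w′ ≤ w →
                 Segment x y P b w → Segment x y Q b w′
  segment-mono P⊆Q w′≤w s .route t t≤w′ with s .route t (≤-trans t≤w′ w′≤w)
  ... | vs , walk , len , uniq , all = vs , walk , len , uniq , All.map P⊆Q all

  segment-++ : ∀ {x y z b b′ w w′} {P Q R : V → Set} →
               (∀ {v} → P v → R v) → (∀ {v} → Q v → R v) → (∀ {v} → P v → ¬ Q v) →
               Segment x y P b w → Segment y z Q b′ w′ → Segment x z R (b + b′) (w + w′)
  -- The first segment takes as many of the `t` detours as it can, the second one the rest.
  segment-++ {b = b} {b′} {w} {w′} P⊆R Q⊆R P⊥Q s s′ .route t t≤
    with s .route (w ⊓ t) (m⊓n≤m w t) | s′ .route (t ∸ w) (m≤n+o⇒m∸n≤o t w t≤)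
  ... | vs , p , len , uniq , all | vs′ , p′ , len′ , uniq′ , all′ =
    vs ++ vs′ , p ++ʷ p′ ,
    trans (length-++ vs) (trans (cong₂ _+_ len len′) (trans
      (solve 4 (λ b b′ x y → b :+ (x :+ x) :+ (b′ :+ (y :+ y)) := b :+ b′ :+ ((x :+ y) :+ (x :+ y))) refl
        b b′ (w ⊓ t) (t ∸ w))
      (cong (λ x → b + b′ + (x + x)) (m⊓n+n∸m≡n w t)))) ,
    Unique.++⁺ uniq uniq′ (λ (v∈ , v∈′) → P⊥Q (All.lookup all v∈) (All.lookup all′ v∈′)) ,
    All.++⁺ (All.map P⊆R all) (All.map Q⊆R all′)

  segment-[] : ∀ {x P} → Segment x x P 0 0
  segment-[] .route zero _ = [] , [] , refl , [] , []

  segment-edge : ∀ {x y} → Adjacent x y → Segment x y (_≡ x) 1 0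
  segment-edge e .route zero _ = _ ∷ [] , e ∷ [] , refl , [] ∷ [] , refl ∷ []

  -- Membership in the right side of block `i`, treating right vertices, extra vertices and the next
  -- cut vertex alike.
  Head : Fin (suc d) → V → Set
  Head i y = ∀ {x} → Tail x → idx x ≡ i → Dir x y

  tail-not-right : ∀ {v} → Tail v → ¬ Right v
  tail-not-right cut  ()
  tail-not-right left ()

  head-cut : ∀ {i j} → Next i j → Head i (cut j)
  head-cut nx tx refl = outer tx nx

  -- Zigzags inside a block.

  zigzag : ∀ {t} → (Fin t → V) → (Fin t → V) → List V
  zigzag {zero}  l r = []
  zigzag {suc t} l r = r zero ∷ l zero ∷ zigzag (l ∘ suc) (r ∘ suc)

  zigzag-length : ∀ {t} (l r : Fin t → V) → length (zigzag l r) ≡ t + t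
  zigzag-length {zero}  l r = refl
  zigzag-length {suc t} l r = cong suc (trans (cong suc (zigzag-length (l ∘ suc) (r ∘ suc))) (≡-sym (+-suc t t)))

  zigzag-all : ∀ {t} {P : V → Set} (l r : Fin t → V) → (∀ a → P (l a)) → (∀ a → P (r a)) → All P (zigzag l r)
  zigzag-all {zero}  l r pl pr = []
  zigzag-all {suc t} l r pl pr = pr zero ∷ pl zero ∷ zigzag-all (l ∘ suc) (r ∘ suc) (pl ∘ suc) (pr ∘ suc)

  zigzag-unique : ∀ {t} (l r : Fin t → V) → Injective _≡_ _≡_ l → Injective _≡_ _≡_ r →
                  (∀ a b → l a ≢ r b) → Unique (zigzag l r)
  zigzag-unique {zero}  l r l-inj r-inj l≢r = []
  zigzag-unique {suc t} l r l-inj r-inj l≢r =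
    ((λ eq → l≢r zero zero (≡-sym eq)) ∷
      zigzag-all _ _ (λ a eq → l≢r (suc a) zero (≡-sym eq)) (λ a eq → 0≢suc (r-inj eq))) ∷
    zigzag-all _ _ (λ a eq → 0≢suc (l-inj eq)) (λ a → l≢r zero (suc a)) ∷
    zigzag-unique (l ∘ suc) (r ∘ suc) (suc-injective ∘ l-inj) (suc-injective ∘ r-inj) (λ a b → l≢r (suc a) (suc b))
    where
    0≢suc : ∀ {n} {a : Fin n} → zero ≢ suc a
    0≢suc ()

  zigzag-walk : ∀ {i t x y} (l r : Fin t → V) → Tail x → idx x ≡ i → Head i y →
                (∀ a → Tail (l a) × idx (l a) ≡ i) → (∀ a → Head i (r a)) → Walk x (x ∷ zigzag l r) y
  zigzag-walk {t = zero}  l r tx ix hy tl hr = inj₁ (hy tx ix) ∷ []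
  zigzag-walk {t = suc t} l r tx ix hy tl hr =
    inj₁ (hr zero tx ix) ∷ inj₂ (hr zero (proj₁ (tl zero)) (proj₂ (tl zero))) ∷
    zigzag-walk (l ∘ suc) (r ∘ suc) (proj₁ (tl zero)) (proj₂ (tl zero)) hy (tl ∘ suc) (hr ∘ suc)

  -- The index that detours have to skip. Cut and extra vertices never occur in a detour; for them
  -- the default `zero` keeps the number of fillers on each side at `c`.
  hole : V → Fin (suc c)
  hole (left _ a)  = a
  hole (right _ a) = a
  hole _           = zero

  data Filler (i : Fin (suc d)) (p q : V) : V → Set where
    left  : ∀ a → Filler i p q (left i (punchIn (hole p) a))
    right : ∀ a → Filler i p q (right i (punchIn (hole q) a))

  Filler-idx : ∀ {i p q v} → Filler i p q v → idx v ≡ i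
  Filler-idx (left _)  = refl
  Filler-idx (right _) = refl

  Filler-≢-cut : ∀ {i p q v j} → Filler i p q v → v ≢ cut j
  Filler-≢-cut (left _)  ()
  Filler-≢-cut (right _) ()

  Filler-≢-tail : ∀ {i p q v} → Filler i p q v → Tail p → v ≢ p
  Filler-≢-tail f         cut  = Filler-≢-cut f
  Filler-≢-tail {p = left _ b} (left a) left eq = punchInᵢ≢i b a (cong hole eq)
  Filler-≢-tail (right _) left ()

  Filler-≢-right : ∀ {i p q v} → Filler i p q v → Right q → v ≢ q
  Filler-≢-right (left _) right ()
  Filler-≢-right {q = right _ b} (right a) right eq = punchInᵢ≢i b a (cong hole eq)
  Filler-≢-right (left _) extra ()
  Filler-≢-right (right _) extra ()

  -- The edge from `x` to `y` is lengthened by up to `c` pairs of fillers. These skip the hole of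
  -- `p` on the left and that of `q` on the right, and `x` is either `p` or a cut vertex, so it is
  -- not a filler.
  segment-zigzag : ∀ {x y p} q → Tail x → Tail p → x ≡ p ⊎ (∃ λ j → x ≡ cut j) → Head (idx x) y →
                   Segment x y (λ v → v ≡ x ⊎ Filler (idx x) p q v) 1 c
  segment-zigzag {x} {y} {p} q tx tp x∈ hy .route t t≤c =
    x ∷ zigzag l r ,
    zigzag-walk l r tx refl hy (λ a → left , refl) (λ a tu iu → inner tu right iu) ,
    cong suc (zigzag-length l r) ,
    All.map (λ f eq → fresh x∈ f (≡-sym eq)) fillers ∷ zigzag-unique l r l-inj r-inj (λ _ _ ()) ,
    inj₁ refl ∷ All.map inj₂ fillers
    where
    l r : Fin t → V
    l a = left (idx x) (punchIn (hole p) (inject≤ a t≤c))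
    r a = right (idx x) (punchIn (hole q) (inject≤ a t≤c))
    l-inj : Injective _≡_ _≡_ l
    l-inj eq = inject≤-injective t≤c t≤c _ _ (punchIn-injective (hole p) _ _ (cong hole eq))
    r-inj : Injective _≡_ _≡_ r
    r-inj eq = inject≤-injective t≤c t≤c _ _ (punchIn-injective (hole q) _ _ (cong hole eq))
    fillers : All (Filler (idx x) p q) (zigzag l r)
    fillers = zigzag-all l r (λ a → left _) (λ a → right _)
    fresh : x ≡ p ⊎ (∃ λ j → x ≡ cut j) → ∀ {v} → Filler (idx x) p q v → v ≢ x
    fresh (inj₁ refl)       f = Filler-≢-tail f tp
    fresh (inj₂ (j , refl)) f = Filler-≢-cut f

  -- Leaving and entering a block.

  InBlock : Fin (suc d) → V → Set
  InBlock i v = idx v ≡ i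

  exit-tail : ∀ {u j} → Tail u → Next (idx u) j → Segment u (cut j) (InBlock (idx u)) 1 c
  exit-tail {u} tu nx = segment-mono (λ { (inj₁ refl) → refl ; (inj₂ f) → Filler-idx f }) ≤-refl
    (segment-zigzag {p = u} u tu tu (inj₁ refl) (head-cut nx))

  exit-right : ∀ {u j} → Right u → Next (idx u) j → Segment u (cut j) (InBlock (idx u)) 2 c
  exit-right {u} ru nx =
    segment-++ (cong idx) (λ { (inj₁ refl) → refl ; (inj₂ f) → Filler-idx f })
      (λ { v≡u (inj₁ v≡l₀) → tail-not-right (subst Tail (≡-sym v≡l₀) left) (subst Right (≡-sym v≡u) ru)
         ; v≡u (inj₂ f)    → Filler-≢-right f ru v≡u })
      (segment-edge (inj₂ (inner left ru refl)))
      (segment-zigzag {x = l₀} {p = l₀} u left left (inj₁ refl) (head-cut nx))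
    where l₀ = left (idx u) zero

  Before : V → V → Set
  Before w v = idx v ≡ idx w × v ≢ w

  entry-right : ∀ {w} → Right w → Segment (cut (idx w)) w (Before w) 1 c
  entry-right {w} rw = segment-mono
    (λ { (inj₁ refl) → refl , (λ eq → tail-not-right cut (subst Right (≡-sym eq) rw)) ; (inj₂ f) → Filler-idx f , Filler-≢-right f rw }) ≤-refl
    (segment-zigzag {p = cut (idx w)} w cut cut (inj₁ refl) (λ tx ix → inner tx rw ix))

  -- The last edge comes from `r₀`, so the zigzag leads to `r₀` and its fillers avoid both `r₀` and
  -- the target.
  entry-left : ∀ {i a} → Segment (cut i) (left i a) (Before (left i a)) 2 c
  entry-left {i} {a} = segment-mono (λ p → p) (m≤m+n c 0)
    (segment-++ (λ { (inj₁ refl) → refl , (λ ()) ; (inj₂ f) → Filler-idx f , Filler-≢-tail f left })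
      (λ { refl → refl , λ () })
      (λ { (inj₁ refl) () ; (inj₂ f) refl → Filler-≢-right f right refl })
      (segment-zigzag {p = left i a} r₀ cut left (inj₂ (i , refl)) (λ tx ix → inner tx right ix))
      (segment-edge (inj₂ (inner left right refl))))
    where r₀ = right i zero

  exitLength entryLength entryWidth : V → ℕ
  exitLength (cut _)     = 1
  exitLength (left _ _)  = 1
  exitLength (right _ _) = 2
  exitLength (extra _)   = 2
  entryLength (cut _)     = 0
  entryLength (left _ _)  = 2
  entryLength (right _ _) = 1
  entryLength (extra _)   = 1
  entryWidth (cut _) = 0
  entryWidth _       = c

  exit : ∀ u {j} → Next (idx u) j → Segment u (cut j) (InBlock (idx u)) (exitLength u) c
  exit (cut _)     = exit-tail cut
  exit (left _ _)  = exit-tail left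
  exit (right _ _) = exit-right right
  exit (extra _)   = exit-right extra

  entry : ∀ w → Segment (cut (idx w)) w (Before w) (entryLength w) (entryWidth w)
  entry (cut _)     = segment-[]
  entry (left _ _)  = entry-left
  entry (right _ _) = entry-right right
  entry (extra _)   = entry-right extra

  -- The two cut vertices of a block lie on opposite sides, so the distances to them differ in
  -- parity.
  parity-exit : ∀ u → parity (exitLength u) ≡ not (parity (entryLength u))
  parity-exit (cut _)     = refl
  parity-exit (left _ _)  = refl
  parity-exit (right _ _) = refl
  parity-exit (extra _)   = refl

  -- Passing through consecutive blocks.

  successor : ∀ {i : Fin (suc d)} → toℕ i < d → ∃ λ (j : Fin (suc d)) → toℕ j ≡ suc (toℕ i)
  successor i<d = fromℕ< (s≤s i<d) , toℕ-fromℕ< (s≤s i<d)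

  chain : ∀ s {i j} → toℕ j ≡ toℕ i + s →
          Segment (cut i) (cut j) (λ v → toℕ i ≤ toℕ (idx v) × toℕ (idx v) < toℕ j) s (s * c)
  chain zero {i} {j} j≡ with toℕ-injective {i = j} {i} (trans j≡ (+-identityʳ _))
  ... | refl = segment-[]
  chain (suc s) {i} {j} j≡ with successor {i} (<-≤-trans i<j (≤-pred (toℕ<n j)))
    where
    i<j : toℕ i < toℕ j
    i<j = subst (toℕ i <_) (≡-sym j≡) (m<m+n (toℕ i) (s≤s z≤n))
  ... | i′ , i′≡ = segment-++
    (λ { {v} refl → ≤-refl , subst (toℕ (idx v) <_) (≡-sym j≡) (m<m+n (toℕ (idx v)) (s≤s z≤n)) })
    (λ (i′≤ , <j) → ≤-trans (n≤1+n _) (subst (_≤ _) i′≡ i′≤) , <j)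
    (λ { refl (i′≤ , _) → 1+n≰n (subst (_≤ _) i′≡ i′≤) })
    (exit-tail cut (step i′≡))
    (chain s {i′} {j} (trans j≡ (trans (+-suc (toℕ i) s) (cong (_+ s) (≡-sym i′≡)))))

  chain-to-zero : ∀ s {i} → toℕ i + s ≡ d →
                  Segment (cut i) (cut zero) (λ v → toℕ i ≤ toℕ (idx v)) (suc s) (suc s * c)
  chain-to-zero zero {i} i≡ = segment-mono (λ { refl → ≤-refl }) (≤-reflexive (+-identityʳ c))
    (exit-tail cut (wrap (trans (≡-sym (+-identityʳ _)) i≡) refl))
  chain-to-zero (suc s) {i} i≡ with successor {i} (subst (toℕ i <_) i≡ (m<m+n (toℕ i) (s≤s z≤n)))
  ... | i′ , i′≡ = segment-++
    (λ { refl → ≤-refl })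
    (λ i′≤ → ≤-trans (n≤1+n _) (subst (_≤ _) i′≡ i′≤))
    (λ { refl i′≤ → 1+n≰n (subst (_≤ _) i′≡ i′≤) })
    (exit-tail cut (step i′≡))
    (chain-to-zero s {i′} (trans (cong (_+ s) i′≡) (trans (≡-sym (+-suc (toℕ i) s)) i≡)))

  -- A segment through the blocks strictly between block i and block j, in the direction of the ring.
  record Arc (i j : Fin (suc d)) : Set where
    field
      start    : Fin (suc d)
      next     : Next i start
      gap      : ℕ
      segment  : Segment (cut start) (cut j) (λ v → idx v ≢ i × idx v ≢ j) gap (gap * c)
      adjacent : gap ≡ 0 → start ≡ j

  arc-ascending : ∀ {i j} → toℕ i < toℕ j → ∃ λ (A : Arc i j) → Arc.gap A + suc (toℕ i) ≡ toℕ j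
  arc-ascending {i} {j} i<j with successor {i} (<-≤-trans i<j (≤-pred (toℕ<n j))) | m≤n⇒∃[o]m+o≡n i<j
  ... | i′ , i′≡ | s , s≡ = record
    { start    = i′
    ; next     = step i′≡
    ; gap      = s
    ; segment  = segment-mono
        (λ (i′≤ , <j) → (λ { refl → 1+n≰n (subst (_≤ _) i′≡ i′≤) }) , (λ { refl → <-irrefl refl <j }))
        ≤-refl (chain s (≡-sym (trans (cong (_+ s) i′≡) s≡)))
    ; adjacent = λ { refl → toℕ-injective (trans i′≡ (trans (≡-sym (+-identityʳ _)) s≡)) }
    } , trans (+-comm s _) s≡

  -- The case `i ≡ j` is included: the arc then runs through all `d` other blocks.
  arc-wrapping : ∀ {i j} → toℕ j ≤ toℕ i → ∃ λ (A : Arc i j) → Arc.gap A + suc (toℕ i) ≡ suc d + toℕ j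
  arc-wrapping {i} {j} j≤i with m≤n⇒m<n∨m≡n (≤-pred (toℕ<n i))
  ... | inj₂ i≡d = record
    { start    = zero
    ; next     = wrap i≡d refl
    ; gap      = toℕ j
    ; segment  = segment-mono
        (λ (_ , <j) → (λ { refl → <-irrefl refl (<-≤-trans <j j≤i) }) , (λ { refl → <-irrefl refl <j }))
        ≤-refl (chain (toℕ j) refl)
    ; adjacent = λ j≡0 → toℕ-injective (≡-sym j≡0)
    } , trans (cong (λ x → toℕ j + suc x) i≡d) (+-comm (toℕ j) (suc d))
  -- Climb through block `d` to `cut zero`, then on to `cut j`.
  ... | inj₁ i<d with successor {i} i<d | m≤n⇒∃[o]m+o≡n i<d
  ...   | i′ , i′≡ | s , s≡ = record
    { start    = i′
    ; next     = step i′≡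
    ; gap      = suc s + toℕ j
    ; segment  = segment-mono (λ p → p) (≤-reflexive (*-distribʳ-+ c (suc s) (toℕ j)))
        (segment-++
          (λ i′≤ → (λ { refl → 1+n≰n (subst (_≤ _) i′≡ i′≤) }) ,
                   (λ { refl → 1+n≰n (≤-trans (subst (_≤ _) i′≡ i′≤) j≤i) }))
          (λ (_ , <j) → (λ { refl → <-irrefl refl (<-≤-trans <j j≤i) }) , (λ { refl → <-irrefl refl <j }))
          (λ i′≤ (_ , <j) → 1+n≰n (<-≤-trans (<-≤-trans <j j≤i) (≤-trans (n≤1+n _) (subst (_≤ _) i′≡ i′≤))))
          (chain-to-zero s {i′} (trans (cong (_+ s) i′≡) s≡))
          (chain (toℕ j) {zero} {j} refl))
    ; adjacent = λ ()
    } , trans (solve 3 (λ s j i → con 1 :+ s :+ j :+ (con 1 :+ i) := con 1 :+ (con 1 :+ i :+ s) :+ j) refl s (toℕ j) (toℕ i))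
          (cong (λ x → suc x + toℕ j) s≡)

  -- Paths of length 2k - 1 between nonadjacent vertices.

  Path : V → V → ℕ → Set
  Path u w n = ∃ λ vs → Walk u vs w × length vs ≡ n × Unique vs × All (_≢ w) vs

  tail? : ∀ v → Tail v ⊎ Right v
  tail? (cut _)     = inj₁ cut
  tail? (left _ _)  = inj₁ left
  tail? (right _ _) = inj₂ right
  tail? (extra _)   = inj₂ extra

  1≤exitLength : ∀ u → 1 ≤ exitLength u
  1≤exitLength (cut _)     = s≤s z≤n
  1≤exitLength (left _ _)  = s≤s z≤n
  1≤exitLength (right _ _) = s≤s z≤n
  1≤exitLength (extra _)   = s≤s z≤n

  exitLength≤2 : ∀ u → exitLength u ≤ 2
  exitLength≤2 (cut _)     = s≤s z≤n
  exitLength≤2 (left _ _)  = s≤s z≤n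
  exitLength≤2 (right _ _) = ≤-refl
  exitLength≤2 (extra _)   = ≤-refl

  entryLength≤2 : ∀ w → entryLength w ≤ 2
  entryLength≤2 (cut _)     = z≤n
  entryLength≤2 (left _ _)  = ≤-refl
  entryLength≤2 (right _ _) = s≤s z≤n
  entryLength≤2 (extra _)   = s≤s z≤n

  -- The exit gives `c` detours. Another `c` come from the entry or, if `w` is a cut vertex, from a
  -- block in the gap. If that gap is empty too, `u` is no tail by assumption, and otherwise the
  -- length is 2, which is even.
  route-wide : ∀ u w g → parity (exitLength u + (g + entryLength w)) ≡ true →
               (g ≡ 0 → Tail u → ∀ j → w ≢ cut j) →
               2 ≤ exitLength u + (g + entryLength w) × c + c ≤ c + (g * c + entryWidth w)
  route-wide u (left _ _)  g _ _ =
    +-mono-≤ (1≤exitLength u) (≤-trans (s≤s z≤n) (m≤n+m 2 g)) , +-monoʳ-≤ c (m≤n+m c (g * c))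
  route-wide u (right _ _) g _ _ =
    +-mono-≤ (1≤exitLength u) (m≤n+m 1 g) , +-monoʳ-≤ c (m≤n+m c (g * c))
  route-wide u (extra _)   g _ _ =
    +-mono-≤ (1≤exitLength u) (m≤n+m 1 g) , +-monoʳ-≤ c (m≤n+m c (g * c))
  route-wide u (cut j) (suc g) _ _ =
    +-mono-≤ (1≤exitLength u) (s≤s z≤n) , +-monoʳ-≤ c (≤-trans (m≤m+n c (g * c)) (m≤m+n _ 0))
  route-wide (cut _)     (cut j) zero _ apart = contradiction refl (apart refl cut j)
  route-wide (left _ _)  (cut j) zero _ apart = contradiction refl (apart refl left j)
  route-wide (right _ _) (cut j) zero () _
  route-wide (extra _)   (cut j) zero () _

  module Saturation {h} (even-d : parity d ≡ false) (2≤d : 2 ≤ d) (2+d≤h+h : 2 + d ≤ h + h) (h≤1+c+c : h ≤ suc (c + c)) where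

    -- With `k = h + 1`, the target length is `2k - 1`. An odd `b` with `2 ≤ b` is at least 3, so at
    -- most `h - 1` detours are needed, and `h - 1 ≤ c + c`.
    select : ∀ {u w b W} → Segment u w (_≢ w) b W → parity b ≡ true → 2 ≤ b → b ≤ 3 + d → c + c ≤ W →
             Path u w (suc (h + h))
    select {b = b} {W} s odd 2≤b b≤ c+c≤W with halve b
    ... | q , inj₁ refl = contradiction (trans (≡-sym odd) (parity-double q)) λ ()
    ... | zero , inj₂ refl = contradiction 2≤b λ { (s≤s ()) }
    ... | suc q , inj₂ refl with m≤n⇒∃[o]m+o≡n (double-cancel-≤ (≤-trans (≤-pred b≤) 2+d≤h+h))
    ...   | t , t≡ with s .route t (≤-trans (m≤n+m t q) (≤-trans (≤-pred (subst (_≤ suc (c + c)) (≡-sym t≡) h≤1+c+c)) c+c≤W))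
    ...     | vs , walk , len , uniq , all = vs , walk , trans len (trans
      (solve 2 (λ q t → con 1 :+ (q :+ q) :+ (t :+ t) := con 1 :+ (q :+ t :+ (q :+ t))) refl (suc q) t)
      (cong (λ x → suc (x + x)) t≡)) , uniq , all

    path-along : ∀ {u w} (A : Arc (idx u) (idx w)) → idx u ≢ idx w → ¬ Adjacent u w → Arc.gap A < d →
                 parity (exitLength u + (Arc.gap A + entryLength w)) ≡ true → Path u w (suc (h + h))
    path-along {u} {w} A u≢w u≁w gap<d odd = select
      (segment-++ (λ { eq refl → u≢w (≡-sym eq) }) (λ { (inj₁ (_ , ne)) refl → ne refl ; (inj₂ (_ , ne)) → ne })
        (λ { eq (inj₁ (ne , _)) → ne eq ; eq (inj₂ (eq′ , _)) → u≢w (trans (≡-sym eq) eq′) })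
        (exit u next)
        (segment-++ inj₁ inj₂ (λ (_ , ne) (eq , _) → ne eq) segment (entry w)))
      odd (proj₁ wide)
      -- Exit and entry take at most two steps each, and the gap at most `d - 1`.
      (≤-trans (+-mono-≤ (exitLength≤2 u) (+-monoʳ-≤ gap (entryLength≤2 w)))
        (s≤s (s≤s (≤-trans (≤-reflexive (+-comm gap 2)) (s≤s gap<d)))))
      (proj₂ wide)
      where
      open Arc A
      wide = route-wide u w gap odd λ { gap≡0 tu j refl →
        u≁w (inj₁ (outer tu (subst (Next (idx u)) (adjacent gap≡0) next))) }

    -- The two arcs miss just two of the `suc d` blocks, so their gaps add up to the odd number
    -- `d - 1`. By `parity-exit` the lengths of the two routes then have an odd sum, so one of them
    -- is odd.
    path-apart : ∀ {u w} → toℕ (idx u) < toℕ (idx w) → ¬ Adjacent u w → Path u w (suc (h + h)) ⊎ Path w u (suc (h + h))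
    path-apart {u} {w} u<w u≁w with arc-ascending {idx u} {idx w} u<w | arc-wrapping {idx w} {idx u} (<⇒≤ u<w)
    ... | A , gapA | B , gapB = case odd-route of λ
      { (inj₁ odd) → inj₁ (path-along A (λ eq → <⇒≢ u<w (cong toℕ eq)) u≁w gapA<d odd)
      ; (inj₂ odd) → inj₂ (path-along B (λ eq → <⇒≢ u<w (cong toℕ (≡-sym eq))) (u≁w ∘ swap) gapB<d odd) }
      where
      open Arc
      gaps : suc (gap A + gap B) ≡ d
      gaps = +-cancelʳ-≡ (suc (toℕ (idx w)) + toℕ (idx u)) _ _ (begin
        suc (gap A + gap B) + (suc (toℕ (idx w)) + toℕ (idx u))        ≡⟨ solve 4 (λ a b i j →
            con 1 :+ (a :+ b) :+ (con 1 :+ j :+ i) := (a :+ (con 1 :+ i)) :+ (b :+ (con 1 :+ j))) refl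
            (gap A) (gap B) (toℕ (idx u)) (toℕ (idx w)) ⟩
        (gap A + suc (toℕ (idx u))) + (gap B + suc (toℕ (idx w)))      ≡⟨ cong₂ _+_ gapA gapB ⟩
        toℕ (idx w) + (suc d + toℕ (idx u))                            ≡⟨ solve 3 (λ d i j →
            j :+ (con 1 :+ d :+ i) := d :+ (con 1 :+ j :+ i)) refl d (toℕ (idx u)) (toℕ (idx w)) ⟩
        d + (suc (toℕ (idx w)) + toℕ (idx u))                          ∎)
        where open ≡-Reasoning
      gapA<d : gap A < d
      gapA<d = subst (gap A <_) gaps (s≤s (m≤m+n (gap A) (gap B)))
      gapB<d : gap B < d
      gapB<d = subst (gap B <_) gaps (s≤s (m≤n+m (gap B) (gap A)))
      expand : ∀ x y z → parity (x + (y + z)) ≡ parity x xor (parity y xor parity z)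
      expand x y z = trans (parity-+ x (y + z)) (cong (parity x xor_) (parity-+ y z))
      parities : ∀ a b g g′ → not (g xor g′) ≡ false →
                 (not a xor (g xor b) ≡ true) ⊎ (not b xor (g′ xor a) ≡ true)
      parities false false false true  _ = inj₁ refl
      parities false false true  false _ = inj₂ refl
      parities false true  false true  _ = inj₂ refl
      parities false true  true  false _ = inj₁ refl
      parities true  false false true  _ = inj₂ refl
      parities true  false true  false _ = inj₁ refl
      parities true  true  false true  _ = inj₁ refl
      parities true  true  true  false _ = inj₂ refl
      odd-route : parity (exitLength u + (gap A + entryLength w)) ≡ true ⊎
                  parity (exitLength w + (gap B + entryLength u)) ≡ true
      odd-route rewrite expand (exitLength u) (gap A) (entryLength w) | expand (exitLength w) (gap B) (entryLength u)
        | parity-exit u | parity-exit w =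
        parities (parity (entryLength u)) (parity (entryLength w)) (parity (gap A)) (parity (gap B))
          (trans (cong not (≡-sym (parity-+ (gap A) (gap B)))) (trans (cong parity gaps) even-d))

    -- The route passes all `d` other blocks. As `2 ≤ d`, these alone provide `c + c` detours, so
    -- the pieces in the block of `w` may be rigid; their lengths add up to 1 or 3.
    path-around : ∀ {u w P Q b b′} → 1 ≤ b → b + b′ ≤ 3 → parity b xor parity b′ ≡ true →
                  (∀ {j} → Next (idx w) j → Segment u (cut j) P b 0) → Segment (cut (idx w)) w Q b′ 0 →
                  (∀ {v} → P v → Before w v) → (∀ {v} → Q v → Before w v) → (∀ {v} → P v → ¬ Q v) →
                  Path u w (suc (h + h))
    path-around {u} {w} {P} {Q} {b} {b′} 1≤b b+b′≤3 odd out back P⊆ Q⊆ P⊥Q with arc-wrapping {idx w} {idx w} ≤-refl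
    ... | A , gap≡ = select
      (segment-++ (proj₂ ∘ P⊆) (λ { (inj₁ (ne , _)) refl → ne refl ; (inj₂ q) → proj₂ (Q⊆ q) })
        (λ { p (inj₁ (ne , _)) → ne (proj₁ (P⊆ p)) ; p (inj₂ q) → P⊥Q p q })
        (out next)
        (segment-++ inj₁ inj₂ (λ (ne , _) q → ne (proj₁ (Q⊆ q))) segment back))
      (trans (parity-+ b (gap + b′)) (trans (cong (parity b xor_) (trans (parity-+ gap b′)
        (cong (_xor parity b′) (trans (cong parity gap≡d) even-d)))) odd))
      (+-mono-≤ 1≤b (≤-trans (≤-trans (s≤s z≤n) 2≤gap) (m≤m+n gap b′)))
      (≤-trans (≤-reflexive (solve 3 (λ b g b′ → b :+ (g :+ b′) := (b :+ b′) :+ g) refl b gap b′))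
        (+-mono-≤ b+b′≤3 (≤-reflexive gap≡d)))
      (≤-trans (≤-reflexive (cong (c +_) (≡-sym (+-identityʳ c)))) (≤-trans (*-monoˡ-≤ c 2≤gap) (m≤m+n _ 0)))
      where
      open Arc A
      gap≡d : gap ≡ d
      gap≡d = +-cancelʳ-≡ (suc (toℕ (idx w))) gap d (trans gap≡ (≡-sym (+-suc d (toℕ (idx w)))))
      2≤gap : 2 ≤ gap
      2≤gap = subst (2 ≤_) (≡-sym gap≡d) 2≤d

    path-to-cut : ∀ {i a} → Path (left i a) (cut i) (suc (h + h))
    path-to-cut = path-around {Q = λ _ → ⊥} (s≤s z≤n) (s≤s z≤n) refl
      (λ nx → segment-edge (inj₁ (outer left nx))) segment-[]
      (λ { refl → refl , λ () }) (λ ()) (λ _ ())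

    path-left : ∀ {i a b} → a ≢ b → Path (left i a) (left i b) (suc (h + h))
    path-left {i} {a} {b} a≢b = path-around {Q = λ v → v ≡ cut i ⊎ v ≡ right i zero} (s≤s z≤n) ≤-refl refl
      (λ nx → segment-edge (inj₁ (outer left nx)))
      (segment-++ inj₁ inj₂ (λ { refl () }) (segment-edge (inj₁ (inner cut right refl))) (segment-edge (inj₂ (inner left right refl))))
      (λ { refl → refl , λ { refl → a≢b refl } })
      (λ { (inj₁ refl) → refl , (λ ()) ; (inj₂ refl) → refl , (λ ()) })
      (λ { refl (inj₁ ()) ; refl (inj₂ ()) })

    path-right : ∀ {u w} → Right u → Right w → idx u ≡ idx w → u ≢ w → Path u w (suc (h + h))
    path-right {u} {w} ru rw i≡ u≢w = path-around {P = λ v → v ≡ u ⊎ v ≡ l₀} {Q = _≡ cut (idx w)} (s≤s z≤n) ≤-refl refl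
      (λ nx → segment-++ inj₁ inj₂ (λ v≡u v≡l₀ → left≢right ru (trans (≡-sym v≡l₀) v≡u))
        (segment-edge (inj₂ (inner left ru (≡-sym i≡)))) (segment-edge (inj₁ (outer left nx))))
      (segment-edge (inj₁ (inner cut rw refl)))
      (λ { (inj₁ refl) → i≡ , u≢w ; (inj₂ refl) → refl , left≢right rw })
      (λ { refl → refl , cut≢right rw })
      (λ { (inj₁ v≡u) v≡cut → cut≢right ru (trans (≡-sym v≡cut) v≡u) ; (inj₂ refl) () })
      where
      l₀ = left (idx w) zero
      left≢right : ∀ {x} → Right x → l₀ ≢ x
      left≢right rx refl = tail-not-right left rx
      cut≢right : ∀ {x} → Right x → cut (idx w) ≢ x
      cut≢right rx eq = tail-not-right cut (subst Right (≡-sym eq) rx)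

    -- The cut vertex at the right end of the block carries another index and falls under
    -- `path-apart`. Among equal indices, a tail and a right vertex are adjacent, so two tails or
    -- two right vertices remain.
    path-same-block : ∀ {u w} → idx u ≡ idx w → u ≢ w → ¬ Adjacent u w →
                      Path u w (suc (h + h)) ⊎ Path w u (suc (h + h))
    path-same-block {u} {w} i≡ u≢w u≁w with tail? u | tail? w
    ... | inj₁ tu | inj₂ rw = contradiction (inj₁ (inner tu rw i≡)) u≁w
    ... | inj₂ ru | inj₁ tw = contradiction (inj₂ (inner tw ru (≡-sym i≡))) u≁w
    ... | inj₂ ru | inj₂ rw = inj₁ (path-right ru rw i≡ u≢w)
    ... | inj₁ tu | inj₁ tw = tails tu tw i≡ u≢w
      where
      tails : ∀ {u w} → Tail u → Tail w → idx u ≡ idx w → u ≢ w →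
              Path u w (suc (h + h)) ⊎ Path w u (suc (h + h))
      tails cut  cut  refl u≢w = contradiction refl u≢w
      tails cut  left refl u≢w = inj₂ path-to-cut
      tails left cut  refl u≢w = inj₁ path-to-cut
      tails left left refl u≢w = inj₁ (path-left λ { refl → u≢w refl })

    path-nonadjacent : ∀ {u w} → u ≢ w → ¬ Adjacent u w → Path u w (suc (h + h)) ⊎ Path w u (suc (h + h))
    path-nonadjacent {u} {w} u≢w u≁w with <-cmp (toℕ (idx u)) (toℕ (idx w))
    ... | tri< u<w _ _ = path-apart u<w u≁w
    ... | tri≈ _ i≡ _  = path-same-block (toℕ-injective i≡) u≢w u≁w
    ... | tri> _ _ w<u = swap (path-apart w<u (u≁w ∘ swap))

  -- Realisation on Fin n

  size : ℕ
  size = suc d + (suc d * suc c + (suc d * suc c + e))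

  enumeration : Fin size ↔ V
  enumeration = ↔-trans (↔-trans +↔⊎ (↔-refl ⊎-↔ ↔-trans +↔⊎ (*↔× ⊎-↔ ↔-trans +↔⊎ (*↔× ⊎-↔ ↔-refl))))
    (mk↔ₛ′ decode encode decode-encode encode-decode)
    where
    Code : Set
    Code = Fin (suc d) ⊎ (Fin (suc d) × Fin (suc c)) ⊎ (Fin (suc d) × Fin (suc c)) ⊎ Fin e
    decode : Code → V
    decode (inj₁ i)                      = cut i
    decode (inj₂ (inj₁ (i , a)))         = left i a
    decode (inj₂ (inj₂ (inj₁ (i , a))))  = right i a
    decode (inj₂ (inj₂ (inj₂ a)))        = extra a
    encode : V → Code
    encode (cut i)     = inj₁ i
    encode (left i a)  = inj₂ (inj₁ (i , a))
    encode (right i a) = inj₂ (inj₂ (inj₁ (i , a)))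
    encode (extra a)   = inj₂ (inj₂ (inj₂ a))
    decode-encode : ∀ v → decode (encode v) ≡ v
    decode-encode (cut _)     = refl
    decode-encode (left _ _)  = refl
    decode-encode (right _ _) = refl
    decode-encode (extra _)   = refl
    encode-decode : ∀ x → encode (decode x) ≡ x
    encode-decode (inj₁ _)               = refl
    encode-decode (inj₂ (inj₁ _))        = refl
    encode-decode (inj₂ (inj₂ (inj₁ _))) = refl
    encode-decode (inj₂ (inj₂ (inj₂ _))) = refl

  vertexAt : ∀ {u vs w} → Walk u vs w → Fin (suc (length vs)) → V
  vertexAt {u} _   zero    = u
  vertexAt (_ ∷ p) (suc i) = vertexAt p i

  vertexAt-last : ∀ {u vs w} (p : Walk u vs w) → vertexAt p (fromℕ (length vs)) ≡ w
  vertexAt-last []      = refl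
  vertexAt-last (_ ∷ p) = vertexAt-last p

  vertexAt-edge : ∀ {u vs w} (p : Walk u vs w) i → Adjacent (vertexAt p (inject₁ i)) (vertexAt p (suc i))
  vertexAt-edge (e ∷ p) zero    = e
  vertexAt-edge (_ ∷ p) (suc i) = vertexAt-edge p i

  vertexAt-all : ∀ {u vs w} {P : V → Set} (p : Walk u vs w) → All P vs → P w → ∀ i → P (vertexAt p i)
  vertexAt-all []      _         pw zero    = pw
  vertexAt-all (_ ∷ p) (pu ∷ _)  pw zero    = pu
  vertexAt-all (_ ∷ p) (_ ∷ pvs) pw (suc i) = vertexAt-all p pvs pw i

  vertexAt-injective : ∀ {u vs w} (p : Walk u vs w) → Unique vs → All (_≢ w) vs → Injective _≡_ _≡_ (vertexAt p)
  vertexAt-injective p         _             _          {zero}  {zero}  _  = refl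
  vertexAt-injective (_ ∷ p) (u≢vs ∷ _)    (u≢w ∷ _)  {zero}  {suc j} eq = contradiction eq (vertexAt-all p u≢vs u≢w j)
  vertexAt-injective (_ ∷ p) (u≢vs ∷ _)    (u≢w ∷ _)  {suc i} {zero}  eq = contradiction (≡-sym eq) (vertexAt-all p u≢vs u≢w i)
  vertexAt-injective (_ ∷ p) (_ ∷ uniq)    (_ ∷ ≢w)   {suc i} {suc j} eq = cong suc (vertexAt-injective p uniq ≢w eq)

  module Labelled {n} (0<d : 0 < d) (labels : Fin n ↔ V) where
    open Inverse labels

    graph : SimpleGraph n
    graph = record
      { Adj    = λ x y → Adjacent (to x) (to y)
      ; sym    = swap
      ; irrefl = Adjacent-irreflexive 0<d
      }

    to-injective : Injective _≡_ _≡_ to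
    to-injective eq = trans (≡-sym (strictlyInverseʳ _)) (trans (cong from eq) (strictlyInverseʳ _))

    unrolled : ∀ {m} → ContainsCycle (Adj graph) (suc m) → CyclicSeq Adjacent (suc m)
    unrolled (_ , f , f-inj , steps , close) = unroll (to ∘ f) (f-inj ∘ to-injective) steps close

    -- Such a cycle would need `suc k` tails in a single block, more than `2 + c`.
    even-cycles-short : parity d ≡ false → ∀ k → 2 + c ≤ k → ¬ ContainsCycle (Adj graph) (suc k + suc k)
    even-cycles-short even-d k 2+c≤k C rewrite +-suc k k =
      <⇒≱ (s≤s 2+c≤k) (EvenCycle.few-tails (parity-double k) even-d (unrolled C) (suc k) (cong suc (+-suc k k)))

    odd-cycles-long : ∀ {m} → m < d → parity (suc m) ≡ true → ¬ ContainsCycle (Adj graph) (suc m)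
    odd-cycles-long {m} m<d odd C@(_ , f , _) =
      <⇒≱ (s≤s m<d) (odd-cycle-long (unrolled C) odd (to ∘ f) (λ s → s mod suc m , refl))

    cycle-closing : ∀ {x y l} {F : Fin n → Fin n → Set} → 2 ≤ l → Path (to x) (to y) l →
                    (∀ {a b} → Adj graph a b → F a b) → F y x → ContainsCycle F (suc l)
    cycle-closing {F = F} 2≤l (vs , walk , refl , uniq , ≢y) Adj⊆F closing =
      s≤s 2≤l , from ∘ vertexAt walk ,
      (λ eq → vertexAt-injective walk uniq ≢y (from-injective eq)) ,
      (λ i → Adj⊆F (subst₂ Adjacent (≡-sym (strictlyInverseˡ _)) (≡-sym (strictlyInverseˡ _)) (vertexAt-edge walk i))) ,
      subst₂ F (≡-sym (trans (cong from (vertexAt-last walk)) (strictlyInverseʳ _))) (≡-sym (strictlyInverseʳ _)) closing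
      where
      from-injective : Injective _≡_ _≡_ from
      from-injective eq = trans (≡-sym (strictlyInverseˡ _)) (trans (cong to eq) (strictlyInverseˡ _))

    saturated : ∀ {h} → parity d ≡ false → 2 ≤ d → 2 + d ≤ h + h → h ≤ suc (c + c) → 2 + c ≤ h →
                CycleSaturated graph (suc h + suc h)
    saturated {h} even-d 2≤d 2+d≤h+h h≤1+c+c 2+c≤h = even-cycles-short even-d h 2+c≤h , add
      where
      open Saturation {h} even-d 2≤d 2+d≤h+h h≤1+c+c
      long : 2 ≤ suc (h + h)
      long = s≤s (≤-trans (s≤s z≤n) 2+d≤h+h)
      add : ∀ x y → x ≢ y → ¬ Adj graph x y → ContainsCycle (AddEdge (Adj graph) x y) (suc h + suc h)
      add x y x≢y x≁y rewrite +-suc h h with path-nonadjacent (x≢y ∘ to-injective) x≁y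
      ... | inj₁ p = cycle-closing {F = AddEdge (Adj graph) x y} long p inj₁ (inj₂ (inj₂ (refl , refl)))
      ... | inj₂ p = cycle-closing {F = AddEdge (Adj graph) x y} long p inj₁ (inj₂ (inj₁ (refl , refl)))

-- Choice of parameters.

ring-fits : ∀ {r h c n} → 5 ≤ r → 4 ≤ h → c + c ≤ h → 2 * suc h * r ≤ n →
            ∃ λ e → Ring.size (suc r) c e ≡ n
ring-fits {suc (suc ρ)} {suc η} {c} {n} (s≤s (s≤s 3≤ρ)) (s≤s 3≤η) c+c≤ large = e ,
  trans (cong (D +_) (≡-sym (+-assoc (D * suc c) (D * suc c) e)))
    (trans (≡-sym (+-assoc D (D * suc c + D * suc c) e)) (proj₂ remainder))
  where
  D = 4 + ρ
  -- The ring without extra vertices has `(r + 2)(3 + 2c)` vertices; the rest of `n` is made up by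
  -- extra ones.
  bound : D + (D * suc c + D * suc c) ≤ 2 * (2 + η) * (2 + ρ)
  bound = begin
    D + (D * suc c + D * suc c)                  ≡⟨ solve 2 (λ D c →
        D :+ (D :* (con 1 :+ c) :+ D :* (con 1 :+ c)) := D :* (con 3 :+ (c :+ c))) refl D c ⟩
    D * (3 + (c + c))                            ≤⟨ *-monoʳ-≤ D (+-monoʳ-≤ 3 c+c≤) ⟩
    (4 + ρ) * (4 + η)                            ≡⟨ solve 2 (λ ρ η →
        (con 4 :+ ρ) :* (con 4 :+ η) := con 8 :+ (con 8 :+ con 4 :* (ρ :+ η) :+ η :* ρ)) refl ρ η ⟩
    -- In terms of `ρ = r - 2` and `η = h - 1`, both at least 3, the bound amounts to `8 ≤ η * ρ`.
    8 + (8 + 4 * (ρ + η) + η * ρ)                ≤⟨ +-monoˡ-≤ _ (≤-trans (n≤1+n 8) (*-mono-≤ 3≤η 3≤ρ)) ⟩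
    η * ρ + (8 + 4 * (ρ + η) + η * ρ)            ≡⟨ solve 2 (λ ρ η →
        η :* ρ :+ (con 8 :+ con 4 :* (ρ :+ η) :+ η :* ρ) := con 2 :* (con 2 :+ η) :* (con 2 :+ ρ)) refl ρ η ⟩
    2 * (2 + η) * (2 + ρ)                        ∎
    where open ≤-Reasoning
  remainder = m≤n⇒∃[o]m+o≡n (≤-trans bound large)
  e = proj₁ remainder

theorem1p3 : (r k : ℕ) → 5 ≤ r → ¬ (2 ∣ r) → r + 5 ≤ 2 * k →
    (n : ℕ) → 2 * k * r ≤ n →
    Σ (SimpleGraph n) λ G → CycleSaturated G (2 * k) × ¬ ContainsCycle (Adj G) r
theorem1p3 r zero 5≤r r-odd r+5≤0 n large = contradiction (≤-trans (m≤n+m 5 r) r+5≤0) λ ()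
theorem1p3 r (suc h) 5≤r r-odd r+5≤2k n large with halve r | halve h
... | q , inj₁ refl | _ = contradiction (divides q (solve 1 (λ q → q :+ q := q :* con 2) refl q)) r-odd
-- Half of `h`, rounded down, is large enough for `h - 1` detours in two blocks and small enough for
-- `2 + c ≤ h < k`.
... | q , inj₂ refl | c , h≡ = build (ring-fits 5≤r 4≤h c+c≤h large)
  where
  r′ = suc (q + q)
  2k≡ : 2 * suc h ≡ suc h + suc h
  2k≡ = cong (suc h +_) (+-identityʳ (suc h))
  3+r≤h+h : 3 + r′ ≤ h + h
  3+r≤h+h = ≤-pred (≤-pred (subst₂ _≤_ (+-comm r′ 5) (trans 2k≡ (cong suc (+-suc h h))) r+5≤2k))
  4≤h : 4 ≤ h
  4≤h = double-cancel-≤ (≤-trans (+-monoʳ-≤ 3 5≤r) 3+r≤h+h)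
  c+c≤h : c + c ≤ h
  c+c≤h = [ (λ eq → ≤-reflexive (≡-sym eq)) , (λ eq → ≤-trans (n≤1+n _) (≤-reflexive (≡-sym eq))) ]′ h≡
  h≤1+c+c : h ≤ suc (c + c)
  h≤1+c+c = [ (λ eq → ≤-trans (≤-reflexive eq) (n≤1+n _)) , ≤-reflexive ]′ h≡
  2≤c : 2 ≤ c
  2≤c = ≮⇒≥ λ c<2 → <⇒≱ (s≤s (+-mono-≤ (≤-pred c<2) (≤-pred c<2))) (≤-pred (≤-trans 4≤h h≤1+c+c))
  -- The ring has `r + 2` blocks, so `d = r + 1`, which is even as `r` is odd.
  even-d : parity (suc r′) ≡ false
  even-d = trans (not-involutive _) (parity-double q)
  build : (∃ λ e → Ring.size (suc r′) c e ≡ n) →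
          Σ (SimpleGraph n) λ G → CycleSaturated G (2 * suc h) × ¬ ContainsCycle (Adj G) r′
  build (e , refl) = graph ,
    subst (CycleSaturated graph) (≡-sym 2k≡)
      (saturated even-d (s≤s (s≤s z≤n)) 3+r≤h+h h≤1+c+c (≤-trans (+-monoˡ-≤ c 2≤c) c+c≤h)) ,
    odd-cycles-long (n≤1+n _) (cong not (parity-double q))
    where
    open Ring (suc r′) c e
    open Labelled (s≤s z≤n) enumeration
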